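{- Let $R$ be a commutative ring with unity, let $m\ge1$ be an integer, and let $\lambda_1:\mathbb N\times\mathbb Z\to R$ be a lambda-recursive family of order $m$ with principal factor $(p_n)_{n\ge m}$ and auxiliary factor $h_{(n,k)}=h_n$ independent of $k$. Assume that $\lambda_1(n,0)\in R^\times$ for all $n\ge0$ and $p_n\in R^\times$ for all $n\ge m$. Let $$f_n(x)=\sum_{b=0}^{w_m(n)}\lambda_1(n,b)\,x^{n-mb}\qquad(n\in\mathbb N),$$ and assume that there exists a family $\lambda_3:\mathbb N\times\mathbb Z\to R$ with triangular support of order $m$ such that, for all $n\in\mathbb N$, $$x^n=\sum_{b=0}^{w_m(n)}\lambda_3(n,b)\,f_{n-mb}(x),\qquad \lambda_1(n,0)\,\lambda_3(n,0)=1.$$ For each pair $(n,k)$ write $t=n-km$ and $s=n-(k-1)m$. Then, for all $n\in\mathbb N$ and all $0\le k\le w_m(n)$, $$\lambda_3(n,k)=\begin{cases}\dfrac{1}{\lambda_1(n,0)},&k=0,\\[8pt] A(n,k)\,\lambda_3(n-1,k)+\dfrac{h_s}{p_s}\,\lambda_3(n-1,k-1),&1\le k\le w_m(n),\end{cases}$$ where $$A(n,k)=\begin{cases}\dfrac{1}{p_t},&t\ge m,\\[6pt] \dfrac{\lambda_1(t-1,0)}{\lambda_1(t,0)},&t\in\{1,\dots,m-1\},\\[8pt] 0,&t=0.\end{cases}$$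
   Context: $\mathbb N=\{0,1,2,\dots\}$, $w_m(n)=\lfloor n/m\rfloor$, and $R^\times$ is the group of units of $R$. A family $\lambda:\mathbb N\times\mathbb Z\to R$ has triangular support of order $m$ (written $\lambda\in\Delta_m$) if $\lambda(n,k)=0$ whenever $k<0$ or $k>w_m(n)$. A family $\lambda_1\in\Delta_m$ is lambda-recursive of order $m$ if there exist $p_n\in R$ (principal factor), $h_{(n,k)}\in R$ (auxiliary factor) and initial data $c_n\in R$ for $0\le n\le m-1$ such that, for all $n\in\mathbb N$ and $0\le k\le w_m(n)$: $\lambda_1(n,0)=c_n$ if $0\le n\le m-1$ (and $k=0$), and $\lambda_1(n,k)=p_n\,\lambda_1(n-1,k)-h_{(n,k)}\,\lambda_1(n-m,k-1)$ if $n\ge m$. -}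

module Defs where

open import Algebra.Bundles using (CommutativeRing)
open import Algebra.Bundles.Raw using (RawMonoid)
import Algebra.Definitions as AlgebraDefinitions
import Algebra.Definitions.RawMonoid as RawMonoidDefinitions
open import Data.Fin.Base using (Fin; toℕ)
open import Data.Integer.Base as ℤ using (ℤ; +_; 0ℤ; 1ℤ)
open import Data.List.Base using (List; []; _∷_; map)
open import Data.Nat.Base as ℕ using (ℕ; zero; suc; _∸_; _/_; NonZero; s≤s)
import Data.Nat.DivMod as DivMod
import Data.Nat.Properties as ℕₚ
open import Data.Product.Base using (proj₁)
open import Data.Sum.Base using (_⊎_)
open import Level using (_⊔_)
open import Relation.Binary.PropositionalEquality using (subst)
open import Relation.Nullary using (yes; no)

w : (m : ℕ) .{{_ : NonZero m}} → ℕ → ℕ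
w m n = n / m

m≤n∸[k∸1]*m : ∀ m .{{_ : NonZero m}} n k → 1 ℕ.≤ k → k ℕ.≤ w m n →
              m ℕ.≤ n ∸ (k ∸ 1) ℕ.* m
m≤n∸[k∸1]*m m n (suc j) (s≤s _) k≤w =
  subst (ℕ._≤ n ∸ j ℕ.* m) (ℕₚ.m+n∸n≡m m (j ℕ.* m))
    (ℕₚ.∸-monoˡ-≤ (j ℕ.* m)
      (ℕₚ.≤-trans (ℕₚ.*-monoˡ-≤ m k≤w) (DivMod.m/n*n≤m n m)))

module Lambda {a ℓ} (R : CommutativeRing a ℓ) where

  open CommutativeRing R
  open AlgebraDefinitions _≈_ using (Invertible)

  IsUnit : Carrier → Set (a ⊔ ℓ)
  IsUnit = Invertible 1# _*_

  inverse : ∀ {x} → IsUnit x → Carrier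
  inverse = proj₁

  -- R[x]: lists of coefficients, constant term first.  Trailing zeros are
  -- allowed, so equality of polynomials is _≈ₚ_ rather than equality of lists.

  Poly : Set a
  Poly = List Carrier

  coeff : Poly → ℕ → Carrier
  coeff []       _       = 0#
  coeff (c ∷ _)  zero    = c
  coeff (_ ∷ cs) (suc i) = coeff cs i

  infix 4 _≈ₚ_
  _≈ₚ_ : Poly → Poly → Set ℓ
  q ≈ₚ r = ∀ i → coeff q i ≈ coeff r i

  infixl 6 _+ₚ_
  _+ₚ_ : Poly → Poly → Poly
  []       +ₚ r        = r
  (c ∷ q)  +ₚ []       = c ∷ q
  (c ∷ q)  +ₚ (d ∷ r)  = (c + d) ∷ (q +ₚ r)

  infixr 7 _•_
  _•_ : Carrier → Poly → Poly
  c • q = map (c *_) q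

  infix 8 x^_
  x^_ : ℕ → Poly
  x^ zero  = 1# ∷ []
  x^ suc n = 0# ∷ x^ n

  +ₚ-rawMonoid : RawMonoid a ℓ
  +ₚ-rawMonoid = record { Carrier = Poly ; _≈_ = _≈ₚ_ ; _∙_ = _+ₚ_ ; ε = [] }

  -- ∑ₚ[ b ≤ N ] e includes both ends b = 0 and b = N; here b : Fin (suc N).
  infixl 5 ∑ₚ-syntax
  ∑ₚ-syntax : ∀ N → (Fin (suc N) → Poly) → Poly
  ∑ₚ-syntax N = RawMonoidDefinitions.sum +ₚ-rawMonoid {suc N}

  syntax ∑ₚ-syntax N (λ b → e) = ∑ₚ[ b ≤ N ] e

  Family : Set a
  Family = ℕ → ℤ → Carrier

  module _ (m : ℕ) .{{_ : NonZero m}} where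

    TriangularSupport : Family → Set ℓ
    TriangularSupport μ =
      ∀ n k → (k ℤ.< 0ℤ ⊎ k ℤ.> + w m n) → μ n k ≈ 0#

    -- The principal factor p and auxiliary factor h are total functions, but
    -- only p n and h n k with m ≤ n and 0 ≤ k ≤ w m n are constrained.
    record LambdaRecursive (μ : Family) (p : ℕ → Carrier)
                           (h : ℕ → ℕ → Carrier) : Set (a ⊔ ℓ) where
      field
        support : TriangularSupport μ
        c       : Fin m → Carrier
        initial : ∀ i → μ (toℕ i) 0ℤ ≈ c i
        step    : ∀ n k → m ℕ.≤ n → k ℕ.≤ w m n →
                  μ n (+ k) ≈ p n * μ (n ∸ 1) (+ k)
                              - h n k * μ (n ∸ m) (+ k ℤ.- 1ℤ)

    f : Family → ℕ → Poly
    f μ n = ∑ₚ[ b ≤ w m n ] (μ n (+ toℕ b) • x^ (n ∸ m ℕ.* toℕ b))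

    module _ (λ₁ : Family) (p : ℕ → Carrier)
             (λ₁-unit : ∀ n → IsUnit (λ₁ n 0ℤ))
             (p-unit : ∀ n → m ℕ.≤ n → IsUnit (p n)) where

      A-below : ℕ → Carrier
      A-below zero    = 0#
      A-below (suc t) = λ₁ t 0ℤ * inverse (λ₁-unit (suc t))

      A-at : ℕ → Carrier
      A-at t with m ℕₚ.≤? t
      ... | yes m≤t = inverse (p-unit t m≤t)
      ... | no  _   = A-below t

      -- A-at takes t = n − km; the truncated subtraction is exact for k ≤ w m n.
      A : ℕ → ℕ → Carrier
      A n k = A-at (n ∸ k ℕ.* m)

{-# OPTIONS --safe #-}
-- The lambda recursion inverts to x f_{r-1} = α_r f_r + β_r f_{r-m}, where
-- α_r = A-at r, and β_r = h_r / p_r for r ≥ m, β_r = 0 otherwise.  Multiplying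
-- the expansion of x^{n-1} by x thus expands x^n in the f_{n-mb} with the
-- claimed coefficients, and such an expansion is unique because the leading
-- coefficients λ₁(n,0) are units.  Polynomials are compared through their
-- coefficients at n - mj, which turns this into the triangular system
-- Σ_b λ₃(n,b) λ₁(n-mb,j-b) = δ_{j,0}.
module Submission where

open import Algebra.Bundles using (CommutativeRing)
import Algebra.Properties.CommutativeMonoid.Sum as CommutativeMonoidSum
import Algebra.Properties.CommutativeSemigroup as CommutativeSemigroupProperties
import Algebra.Properties.Monoid as MonoidProperties
import Algebra.Properties.Ring as RingProperties
import Algebra.Properties.Semiring.Sum as SemiringSum
open import Data.Fin.Base using (Fin; zero; suc; toℕ; fromℕ<; punchIn)
open import Data.Fin.Properties using (toℕ<n; toℕ-fromℕ<; toℕ-injective; punchInᵢ≢i)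
open import Data.Integer.Base as ℤ using (ℤ; +_; -[1+_]; 0ℤ; 1ℤ; _⊖_)
import Data.Integer.Properties as ℤₚ
open import Data.List.Base using ([]; _∷_)
open import Data.Nat.Base as ℕ using (ℕ; zero; suc; _∸_; NonZero; z≤n; s≤s)
import Data.Nat.DivMod as DivMod
open import Data.Nat.Induction using (<-rec)
import Data.Nat.Properties as ℕₚ
open import Data.Product.Base using (_×_; _,_; proj₁; proj₂)
open import Data.Sum.Base using (inj₁; inj₂)
open import Function.Base using (_∘_)
open import Relation.Binary.Definitions using (tri<; tri≈; tri>)
open import Relation.Binary.PropositionalEquality as ≡ using (_≡_; _≢_)
open import Relation.Nullary using (yes; no; contradiction)
open import Defs

b≤w⇒bm≤n : ∀ m .{{_ : NonZero m}} {b n} → b ℕ.≤ w m n → b ℕ.* m ℕ.≤ n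
b≤w⇒bm≤n m {n = n} b≤w = ℕₚ.≤-trans (ℕₚ.*-monoˡ-≤ m b≤w) (DivMod.m/n*n≤m n m)

-- Finite sums and triangular linear systems over a commutative ring.

module Sums {a ℓ} (R : CommutativeRing a ℓ) where

  open CommutativeRing R
  open SemiringSum semiring using (sum; sum-cong-≋; sum-replicate-zero)
  open CommutativeMonoidSum +-commutativeMonoid using (sum-remove; ∑-distrib-+)
  open MonoidProperties *-monoid using (cancelʳ)
  open RingProperties ring using (+-cancelʳ)
  open import Relation.Binary.Reasoning.Setoid setoid

  -- Opaque, so that g can be inferred from ∑< N g.
  opaque
    ∑< : ℕ → (ℕ → Carrier) → Carrier
    ∑< N g = sum {N} (g ∘ toℕ)

    ∑<-cong : ∀ N {g g′} → (∀ b → b ℕ.< N → g b ≈ g′ b) → ∑< N g ≈ ∑< N g′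
    ∑<-cong N g≈g′ = sum-cong-≋ {N} (λ b → g≈g′ (toℕ b) (toℕ<n b))

    ∑<-+ : ∀ N g g′ → ∑< N (λ b → g b + g′ b) ≈ ∑< N g + ∑< N g′
    ∑<-+ N g g′ = ∑-distrib-+ {N} (g ∘ toℕ) (g′ ∘ toℕ)

    ∑<-zero : ∀ N {g} → (∀ b → b ℕ.< N → g b ≈ 0#) → ∑< N g ≈ 0#
    ∑<-zero N g≈0 = trans (∑<-cong N g≈0) (sum-replicate-zero N)

    ∑<-extend : ∀ {N N′ g} → N ℕ.≤ N′ → (∀ b → N ℕ.≤ b → g b ≈ 0#) →
                ∑< N′ g ≈ ∑< N g
    ∑<-extend {N′ = N′} z≤n g≈0 = ∑<-zero N′ (λ b _ → g≈0 b z≤n)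
    ∑<-extend (s≤s N≤N′) g≈0 =
      +-congˡ (∑<-extend N≤N′ (λ b N≤b → g≈0 (suc b) (s≤s N≤b)))

    ∑<-suc : ∀ N g → ∑< (suc N) g ≈ g 0 + ∑< N (g ∘ suc)
    ∑<-suc N g = refl

  -- Both sides come from the sum over 0, ..., N by dropping one vanishing end term; `telescope` is
  -- the identity without the vanishing assumptions.
  ∑<-shift : ∀ N g → g 0 ≈ 0# → g N ≈ 0# → ∑< N g ≈ ∑< N (g ∘ suc)
  ∑<-shift N g g0≈0 gN≈0 = begin
    ∑< N g                ≈⟨ +-identityʳ _ ⟨
    ∑< N g + 0#           ≈⟨ +-congˡ gN≈0 ⟨
    ∑< N g + g N          ≈⟨ telescope N g ⟩
    g 0 + ∑< N (g ∘ suc)  ≈⟨ trans (+-congʳ g0≈0) (+-identityˡ _) ⟩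
    ∑< N (g ∘ suc)        ∎
    where
    telescope : ∀ N g → ∑< N g + g N ≈ g 0 + ∑< N (g ∘ suc)
    telescope zero    g = trans (+-congʳ (∑<-zero 0 λ _ ()))
      (trans (+-comm _ _) (+-congˡ (sym (∑<-zero 0 λ _ ()))))
    telescope (suc N) g = begin
      ∑< (suc N) g + g (suc N)                ≈⟨ +-congʳ (∑<-suc N g) ⟩
      (g 0 + ∑< N (g ∘ suc)) + g (suc N)      ≈⟨ +-assoc _ _ _ ⟩
      g 0 + (∑< N (g ∘ suc) + g (suc N))      ≈⟨ +-congˡ (telescope N (g ∘ suc)) ⟩
      g 0 + (g 1 + ∑< N (λ b → g (2 ℕ.+ b)))  ≈⟨ +-congˡ (∑<-suc N (g ∘ suc)) ⟨
      g 0 + ∑< (suc N) (g ∘ suc)              ∎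

  module _ {N j} (j<1+N : j ℕ.< suc N) where

    others : Fin N → ℕ
    others b = toℕ (punchIn (fromℕ< j<1+N) b)

    others<1+N : ∀ b → others b ℕ.< suc N
    others<1+N b = toℕ<n (punchIn (fromℕ< j<1+N) b)

    others≢j : ∀ b → others b ≢ j
    others≢j b eq = punchInᵢ≢i (fromℕ< j<1+N) b
      (toℕ-injective (≡.trans eq (≡.sym (toℕ-fromℕ< j<1+N))))

    opaque
      unfolding ∑<

      ∑<-remove : ∀ g → ∑< (suc N) g ≈ g j + sum (g ∘ others)
      ∑<-remove g = trans (sum-remove {i = fromℕ< j<1+N} (g ∘ toℕ))
        (+-congʳ (reflexive (≡.cong g (toℕ-fromℕ< j<1+N))))

  ∑<-single : ∀ {N j g} → j ℕ.< N → (∀ b → b ≢ j → b ℕ.< N → g b ≈ 0#) →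
              ∑< N g ≈ g j
  ∑<-single {suc N} {j} {g} j<N g≈0 = begin
    ∑< (suc N) g                 ≈⟨ ∑<-remove j<N g ⟩
    g j + sum (g ∘ others j<N)   ≈⟨ +-congˡ (sum-cong-≋ {N} λ b →
                                      g≈0 _ (others≢j j<N b) (others<1+N j<N b)) ⟩
    g j + sum {N} (λ _ → 0#)     ≈⟨ +-congˡ (sum-replicate-zero N) ⟩
    g j + 0#                     ≈⟨ +-identityʳ _ ⟩
    g j                          ∎

  ∑<-cancel : ∀ {N j g g′} → j ℕ.< N →
              (∀ b → b ≢ j → b ℕ.< N → g b ≈ g′ b) →
              ∑< N g ≈ ∑< N g′ → g j ≈ g′ j
  ∑<-cancel {suc N} {j} {g} {g′} j<N g≈g′ eq = +-cancelʳ _ _ _ (begin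
    g j + sum (g′ ∘ others j<N)    ≈⟨ +-congˡ (sum-cong-≋ {N} λ b →
                                        g≈g′ _ (others≢j j<N b) (others<1+N j<N b)) ⟨
    g j + sum (g ∘ others j<N)     ≈⟨ ∑<-remove j<N g ⟨
    ∑< (suc N) g                   ≈⟨ eq ⟩
    ∑< (suc N) g′                  ≈⟨ ∑<-remove j<N g′ ⟩
    g′ j + sum (g′ ∘ others j<N)   ∎)

  -- Forward substitution by strong induction on `j`: in the equation for `j` the terms with `b > j`
  -- vanish and those with `b < j` agree by induction. The terms at `j` therefore agree too, and the
  -- unit `L j j` cancels.
  triangular-injective :
    ∀ {N} (L : ℕ → ℕ → Carrier) →
    (∀ {b j} → j ℕ.< b → b ℕ.< N → L b j ≈ 0#) →
    (∀ j → j ℕ.< N → Lambda.IsUnit R (L j j)) →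
    ∀ (u v : ℕ → Carrier) →
    (∀ j → j ℕ.< N → ∑< N (λ b → u b * L b j) ≈ ∑< N (λ b → v b * L b j)) →
    ∀ j → j ℕ.< N → u j ≈ v j
  triangular-injective {N} L above diagonal u v eq = <-rec _ step
    where
    step : ∀ j → (∀ {b} → b ℕ.< j → b ℕ.< N → u b ≈ v b) → j ℕ.< N → u j ≈ v j
    step j ih j<N = begin
      u j                   ≈⟨ cancelʳ inv (u j) ⟨
      (u j * L j j) * ljj⁻¹  ≈⟨ *-congʳ (∑<-cancel j<N offDiagonal (eq j j<N)) ⟩
      (v j * L j j) * ljj⁻¹  ≈⟨ cancelʳ inv (v j) ⟩
      v j                   ∎
      where
      ljj⁻¹ = proj₁ (diagonal j j<N)
      inv = proj₂ (proj₂ (diagonal j j<N))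

      offDiagonal : ∀ b → b ≢ j → b ℕ.< N → u b * L b j ≈ v b * L b j
      offDiagonal b b≢j b<N with ℕₚ.<-cmp b j
      ... | tri< b<j _ _ = *-congʳ (ih b<j b<N)
      ... | tri≈ _ b≡j _ = contradiction b≡j b≢j
      ... | tri> _ _ j<b = trans (vanish u) (sym (vanish v))
        where
        vanish : ∀ (t : ℕ → Carrier) → t b * L b j ≈ 0#
        vanish t = trans (*-congˡ (above j<b b<N)) (zeroʳ _)

-- Coefficients of sums, monomials and the polynomials `f`.

module Coefficients {a ℓ} (R : CommutativeRing a ℓ) where

  open CommutativeRing R
  open Lambda R
  open Sums R
  open import Relation.Binary.Reasoning.Setoid setoid

  coeff-+ₚ : ∀ q r i → coeff (q +ₚ r) i ≈ coeff q i + coeff r i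
  coeff-+ₚ []      r       i       = sym (+-identityˡ _)
  coeff-+ₚ (c ∷ q) []      i       = sym (+-identityʳ _)
  coeff-+ₚ (c ∷ q) (d ∷ r) zero    = refl
  coeff-+ₚ (c ∷ q) (d ∷ r) (suc i) = coeff-+ₚ q r i

  coeff-• : ∀ c q i → coeff (c • q) i ≈ c * coeff q i
  coeff-• c []      i       = sym (zeroʳ c)
  coeff-• c (d ∷ q) zero    = refl
  coeff-• c (d ∷ q) (suc i) = coeff-• c q i

  coeff-x^-≡ : ∀ n → coeff (x^ n) n ≈ 1#
  coeff-x^-≡ zero    = refl
  coeff-x^-≡ (suc n) = coeff-x^-≡ n

  coeff-x^-≢ : ∀ n i → i ≢ n → coeff (x^ n) i ≈ 0#
  coeff-x^-≢ zero    zero    i≢n = contradiction ≡.refl i≢n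
  coeff-x^-≢ zero    (suc i) i≢n = refl
  coeff-x^-≢ (suc n) zero    i≢n = refl
  coeff-x^-≢ (suc n) (suc i) i≢n = coeff-x^-≢ n i (i≢n ∘ ≡.cong suc)

  opaque
    unfolding ∑<

    coeff-∑ₚ : ∀ N (c : ℕ → Carrier) (q : ℕ → Poly) i →
               coeff (∑ₚ[ b ≤ N ] (c (toℕ b) • q (toℕ b))) i
                 ≈ ∑< (suc N) (λ b → c b * coeff (q b) i)
    coeff-∑ₚ zero c q i =
      trans (coeff-+ₚ (c 0 • q 0) [] i) (+-congʳ (coeff-• (c 0) (q 0) i))
    coeff-∑ₚ (suc N) c q i =
      trans (coeff-+ₚ (c 0 • q 0) _ i)
            (+-cong (coeff-• (c 0) (q 0) i) (coeff-∑ₚ N (c ∘ suc) (q ∘ suc) i))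

  module _ (m : ℕ) .{{_ : NonZero m}} where

    -- Since `m` is nonzero, the exponents n - mb are distinct, so only `b = j` contributes. Stating
    -- the exponent as an additive equation avoids truncated subtraction and forces `j ≤ w m n`.
    coeff-f : ∀ μ n i j → i ℕ.+ j ℕ.* m ≡ n → coeff (f m μ n) i ≈ μ n (+ j)
    coeff-f μ n i j i+jm≡n = begin
      coeff (f m μ n) i                         ≈⟨ coeff-∑ₚ (w m n) (μ n ∘ +_) (λ b → x^ (n ∸ m ℕ.* b)) i ⟩
      ∑< (suc (w m n)) term                     ≈⟨ ∑<-single (s≤s j≤w) others≈0 ⟩
      μ n (+ j) * coeff (x^ (n ∸ m ℕ.* j)) i    ≡⟨ ≡.cong (λ e → μ n (+ j) * coeff (x^ e) i) n∸mj≡i ⟩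
      μ n (+ j) * coeff (x^ i) i                ≈⟨ *-congˡ (coeff-x^-≡ i) ⟩
      μ n (+ j) * 1#                            ≈⟨ *-identityʳ _ ⟩
      μ n (+ j)                                 ∎
      where
      term : ℕ → Carrier
      term b = μ n (+ b) * coeff (x^ (n ∸ m ℕ.* b)) i

      jm≤n : j ℕ.* m ℕ.≤ n
      jm≤n = ≡.subst (j ℕ.* m ℕ.≤_) i+jm≡n (ℕₚ.m≤n+m _ i)

      j≤w : j ℕ.≤ w m n
      j≤w = ≡.subst (ℕ._≤ w m n) (DivMod.m*n/n≡m j m) (DivMod./-monoˡ-≤ m jm≤n)

      n∸mj≡i : n ∸ m ℕ.* j ≡ i
      n∸mj≡i = ≡.trans (≡.cong₂ _∸_ (≡.sym i+jm≡n) (ℕₚ.*-comm m j))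
                       (ℕₚ.m+n∸n≡m i (j ℕ.* m))

      others≈0 : ∀ b → b ≢ j → b ℕ.< suc (w m n) → term b ≈ 0#
      others≈0 b b≢j (s≤s b≤w) = trans (*-congˡ (coeff-x^-≢ _ i i≢)) (zeroʳ _)
        where
        i≢ : i ≢ n ∸ m ℕ.* b
        i≢ i≡ = b≢j (ℕₚ.*-cancelʳ-≡ b j m (ℕₚ.+-cancelˡ-≡ i _ _
          (≡.trans (≡.cong₂ ℕ._+_ i≡ (ℕₚ.*-comm b m))
            (≡.trans (ℕₚ.m∸n+n≡m (≡.subst (ℕ._≤ n) (ℕₚ.*-comm b m) (b≤w⇒bm≤n m b≤w)))
              (≡.sym i+jm≡n)))))

    coeff-f-above : ∀ μ n i → n ℕ.< i → coeff (f m μ n) i ≈ 0#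
    coeff-f-above μ n i n<i = trans (coeff-∑ₚ (w m n) (μ n ∘ +_) (λ b → x^ (n ∸ m ℕ.* b)) i)
      (∑<-zero (suc (w m n)) λ b _ → trans
        (*-congˡ (coeff-x^-≢ _ i
          (ℕₚ.<⇒≢ (ℕₚ.≤-<-trans (ℕₚ.m∸n≤m n (m ℕ.* b)) n<i) ∘ ≡.sym)))
        (zeroʳ _))

-- Inversion of the lambda recursion: multiplication by x on the `f`.

module LambdaInverse
  {a ℓ} (R : CommutativeRing a ℓ) (m : ℕ) .{{_ : NonZero m}}
  (λ₁ : Lambda.Family R) (p h : ℕ → CommutativeRing.Carrier R)
  (recursive : Lambda.LambdaRecursive R m λ₁ p (λ n _ → h n))
  (λ₁-unit : ∀ n → Lambda.IsUnit R (λ₁ n 0ℤ))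
  (p-unit : ∀ n → m ℕ.≤ n → Lambda.IsUnit R (p n))
  where

  open CommutativeRing R
  open Lambda R
  open Sums R
  open Coefficients R
  open LambdaRecursive recursive using (step) renaming (support to λ₁-support)
  open RingProperties ring using (-‿distribʳ-*)
  open MonoidProperties *-monoid using (cancelˡ)
  open CommutativeSemigroupProperties *-commutativeSemigroup using (x∙yz≈yx∙z)
  open import Relation.Binary.Reasoning.Setoid setoid

  negative : ∀ {μ} → TriangularSupport m μ → ∀ n {k} → k ℤ.< 0ℤ → μ n k ≈ 0#
  negative support n k<0 = support n _ (inj₁ k<0)

  beyond : ∀ {μ} → TriangularSupport m μ → ∀ n {k} → w m n ℕ.< k → μ n (+ k) ≈ 0#
  beyond support n w<k = support n _ (inj₂ (ℤ.+<+ w<k))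

  α : ℕ → Carrier
  α = A-at m λ₁ p λ₁-unit p-unit

  -- The default 0 reflects that for `r < m` the polynomial f_r is a monomial, so no lower f occurs
  -- in x f_{r-1}.
  β : ℕ → Carrier
  β r with m ℕₚ.≤? r
  ... | yes m≤r = h r * inverse (p-unit r m≤r)
  ... | no  _   = 0#

  β-≥ : ∀ r (m≤r : m ℕ.≤ r) → β r ≈ h r * inverse (p-unit r m≤r)
  β-≥ r m≤r with m ℕₚ.≤? r
  -- The inverse is computed from a proof of `m ≤ r`; irrelevance of such proofs identifies the two
  -- choices.
  ... | yes m≤r′ = reflexive (≡.cong (λ z → h r * inverse (p-unit r z)) (ℕₚ.≤-irrelevant m≤r′ m≤r))
  ... | no  m≰r  = contradiction m≤r m≰r

  β-< : ∀ r → r ℕ.< m → β r ≈ 0#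
  β-< r r<m with m ℕₚ.≤? r
  ... | yes m≤r = contradiction m≤r (ℕₚ.<⇒≱ r<m)
  ... | no  _   = refl

  -- Outside 0 ≤ k ≤ `w m n` all three values of `λ₁` vanish, so the recursion extends to every
  -- integer `k`. This is needed because the index `j ⊖ b` may leave that range.
  step-ℤ : ∀ n k → m ℕ.≤ n →
           λ₁ n k ≈ p n * λ₁ (n ∸ 1) k - h n * λ₁ (n ∸ m) (k ℤ.- 1ℤ)
  step-ℤ n k m≤n = go k
    where
    zeros : ∀ {x y z} → x ≈ 0# → y ≈ 0# → z ≈ 0# → x ≈ p n * y - h n * z
    zeros {x} {y} {z} x≈0 y≈0 z≈0 = trans x≈0 (sym (begin
      p n * y - h n * z    ≈⟨ +-cong (*-congˡ y≈0) (-‿cong (*-congˡ z≈0)) ⟩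
      p n * 0# - h n * 0#  ≈⟨ +-cong (zeroʳ _) (-‿cong (zeroʳ _)) ⟩
      0# - 0#              ≈⟨ -‿inverseʳ 0# ⟩
      0#                   ∎))

    go : ∀ k → λ₁ n k ≈ p n * λ₁ (n ∸ 1) k - h n * λ₁ (n ∸ m) (k ℤ.- 1ℤ)
    go -[1+ k ] = zeros (negative λ₁-support n ℤ.-<+)
                        (negative λ₁-support (n ∸ 1) ℤ.-<+)
                        (negative λ₁-support (n ∸ m) ℤ.-<+)
    go (+ k) with k ℕₚ.≤? w m n
    ... | yes k≤w = step n k m≤n k≤w
    go (+ zero)  | no k≰w = contradiction z≤n k≰w
    go (+ suc k) | no k≰w = zeros
      (beyond λ₁-support n w<k)
      (beyond λ₁-support (n ∸ 1)
        (ℕₚ.≤-<-trans (DivMod./-monoˡ-≤ m (ℕₚ.m∸n≤m n 1)) w<k))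
      -- For `m ≤ n` the bound drops by exactly one from `n` to `n ∸ m`, matching the drop from
      -- `suc k` to `k`.
      (beyond λ₁-support (n ∸ m)
        (ℕ.s<s⁻¹ (≡.subst (ℕ._< suc k) (DivMod.m/n≡1+[m∸n]/n m≤n) w<k)))
      where w<k = ℕₚ.≰⇒> k≰w

  -- The coefficientwise form of x f_r = α_{r+1} f_{r+1} + β_{r+1} f_{r+1-m}.
  x*f : ∀ r k → λ₁ r k ≈ α (suc r) * λ₁ (suc r) k
                         + β (suc r) * λ₁ (suc r ∸ m) (k ℤ.- 1ℤ)
  x*f r k with m ℕₚ.≤? suc r
  ... | yes m≤1+r = sym (begin
    p⁻¹ * λ₁ (suc r) k + (h (suc r) * p⁻¹) * Y
      ≈⟨ +-congʳ (*-congˡ (step-ℤ (suc r) k m≤1+r)) ⟩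
    p⁻¹ * (p (suc r) * X - h (suc r) * Y) + (h (suc r) * p⁻¹) * Y
      ≈⟨ +-congʳ (distribˡ _ _ _) ⟩
    (p⁻¹ * (p (suc r) * X) + p⁻¹ * - (h (suc r) * Y)) + (h (suc r) * p⁻¹) * Y
      ≈⟨ +-cong (+-cong (cancelˡ inv X) (sym (-‿distribʳ-* _ _))) (sym (x∙yz≈yx∙z _ _ _)) ⟩
    (X - p⁻¹ * (h (suc r) * Y)) + p⁻¹ * (h (suc r) * Y)
      ≈⟨ trans (+-assoc _ _ _) (trans (+-congˡ (-‿inverseˡ _)) (+-identityʳ X)) ⟩
    X ∎)
    where
    X = λ₁ r k
    Y = λ₁ (suc r ∸ m) (k ℤ.- 1ℤ)
    p⁻¹ = inverse (p-unit (suc r) m≤1+r)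
    inv = proj₁ (proj₂ (p-unit (suc r) m≤1+r))
  -- Here f_r and f_{r+1} are both monomials, and `α (suc r)` is the ratio of their coefficients.
  ... | no m≰1+r = sym (trans (+-congˡ (zeroˡ _)) (trans (+-identityʳ _) (monomial k)))
    where
    w≡0 : ∀ {t} → t ℕ.≤ suc r → w m t ≡ 0
    w≡0 t≤1+r = DivMod.m<n⇒m/n≡0 (ℕₚ.≤-<-trans t≤1+r (ℕₚ.≰⇒> m≰1+r))

    off-zero : ∀ {t} k → t ℕ.≤ suc r → k ≢ 0ℤ → λ₁ t k ≈ 0#
    off-zero -[1+ k ]  _     _   = negative λ₁-support _ ℤ.-<+
    off-zero (+ zero)  _     k≢0 = contradiction ≡.refl k≢0
    off-zero (+ suc k) t≤1+r _   =
      beyond λ₁-support _ (≡.subst (ℕ._< suc k) (≡.sym (w≡0 t≤1+r)) (s≤s z≤n))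

    monomial : ∀ k → A-below m λ₁ p λ₁-unit p-unit (suc r) * λ₁ (suc r) k ≈ λ₁ r k
    monomial k with k ℤₚ.≟ 0ℤ
    ... | yes ≡.refl = trans (*-assoc _ _ _)
      (trans (*-congˡ (proj₁ (proj₂ (λ₁-unit (suc r))))) (*-identityʳ _))
    ... | no k≢0 = trans (*-congˡ (off-zero k ℕₚ.≤-refl k≢0))
      (trans (zeroʳ _) (sym (off-zero k (ℕₚ.n≤1+n r) k≢0)))

  -- Within the range of `coeff-f-L`, this is the coefficient of x^{n-jm} in f_{n-bm}. The signed
  -- difference `j ⊖ b` makes the entries with `j < b` vanish by the support of `λ₁`.
  L : ℕ → ℕ → ℕ → Carrier
  L n b j = λ₁ (n ∸ b ℕ.* m) (j ⊖ b)

  L-above : ∀ n {b j} → j ℕ.< b → L n b j ≈ 0#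
  L-above n {b} {j} j<b = negative λ₁-support _
    (≡.subst (j ⊖ b ℤ.<_) (ℤₚ.n⊖n≡0 j) (ℤₚ.⊖-monoʳ->-< j j<b))

  -- This is `x*f` at r = n - bm and k = j - b. Lowering the degree by `m` and the index by 1
  -- amounts to replacing `b` by `suc b`; the hypothesis makes the successor commute with the
  -- truncated subtraction.
  L-recursion : ∀ n b j → b ℕ.* m ℕ.≤ n →
                L n b j ≈ α (suc n ∸ b ℕ.* m) * L (suc n) b j
                          + β (suc n ∸ b ℕ.* m) * L (suc n) (suc b) j
  L-recursion n b j bm≤n = begin
    L n b j
      ≈⟨ x*f (n ∸ b ℕ.* m) (j ⊖ b) ⟩
    α (suc r) * λ₁ (suc r) (j ⊖ b) + β (suc r) * λ₁ (suc r ∸ m) (j ⊖ b ℤ.- 1ℤ)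
      ≡⟨ ≡.cong (λ t → α t * λ₁ t (j ⊖ b) + β t * λ₁ (t ∸ m) (j ⊖ b ℤ.- 1ℤ))
                (ℕₚ.+-∸-assoc 1 bm≤n) ⟨
    α r⁺ * L (suc n) b j + β r⁺ * λ₁ (r⁺ ∸ m) (j ⊖ b ℤ.- 1ℤ)
      ≡⟨ ≡.cong₂ (λ t k → α r⁺ * L (suc n) b j + β r⁺ * λ₁ t k) r⁺∸m j⊖b-1 ⟩
    α r⁺ * L (suc n) b j + β r⁺ * L (suc n) (suc b) j ∎
    where
    r  = n ∸ b ℕ.* m
    r⁺ = suc n ∸ b ℕ.* m

    r⁺∸m : r⁺ ∸ m ≡ suc n ∸ suc b ℕ.* m
    r⁺∸m = ≡.trans (ℕₚ.∸-+-assoc (suc n) (b ℕ.* m) m)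
                   (≡.cong (suc n ∸_) (ℕₚ.+-comm (b ℕ.* m) m))

    j⊖b-1 : j ⊖ b ℤ.- 1ℤ ≡ j ⊖ suc b
    j⊖b-1 = ≡.trans (ℤₚ.distribˡ-⊖-+-neg 0 j b)
                    (≡.cong (λ c → j ⊖ suc c) (ℕₚ.+-identityʳ b))

  δ : ℕ → Carrier
  δ zero    = 1#
  δ (suc _) = 0#

  coeff-x^-δ : ∀ n j → j ℕ.≤ w m n → coeff (x^ n) (n ∸ j ℕ.* m) ≈ δ j
  coeff-x^-δ n zero    _   = coeff-x^-≡ n
  coeff-x^-δ n (suc j) j≤w = coeff-x^-≢ n _
    (ℕₚ.<⇒≢ (ℕₚ.∸-monoʳ-< (ℕₚ.<-≤-trans (ℕ.>-nonZero⁻¹ m) (ℕₚ.m≤m+n m _)) (b≤w⇒bm≤n m j≤w)))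

  -- For `b ≤ j` this is `coeff-f`, as (n - jm) + (j - b)m = n - bm. For `j < b` the exponent n - jm
  -- exceeds the degree bound n - bm.
  coeff-f-L : ∀ n {b j} → b ℕ.≤ w m n → j ℕ.≤ w m n →
              coeff (f m λ₁ (n ∸ m ℕ.* b)) (n ∸ j ℕ.* m) ≈ L n b j
  coeff-f-L n {b} {j} b≤w j≤w rewrite ℕₚ.*-comm m b with b ℕₚ.≤? j
  ... | yes b≤j rewrite ℤₚ.⊖-≥ b≤j = coeff-f m λ₁ _ _ (j ∸ b) (≡.trans
    (≡.cong ((n ∸ j ℕ.* m) ℕ.+_) (ℕₚ.*-distribʳ-∸ m j b))
    (≡.trans (≡.sym (ℕₚ.+-∸-assoc (n ∸ j ℕ.* m) (ℕₚ.*-monoˡ-≤ m b≤j)))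
      (≡.cong (_∸ b ℕ.* m) (ℕₚ.m∸n+n≡m (b≤w⇒bm≤n m j≤w)))))
  ... | no b≰j = trans (coeff-f-above m λ₁ _ _ (ℕₚ.∸-monoʳ-< (ℕₚ.*-monoˡ-< m j<b) (b≤w⇒bm≤n m b≤w)))
                       (sym (L-above n j<b))
    where j<b = ℕₚ.≰⇒> b≰j

  -- The triangular system for `λ₃` and its uniqueness.

  module _
    (λ₃ : Family) (λ₃-support : TriangularSupport m λ₃)
    (x^-expansion : ∀ n → x^ n ≈ₚ ∑ₚ[ b ≤ w m n ] (λ₃ n (+ toℕ b) • f m λ₁ (n ∸ m ℕ.* toℕ b)))
    where

    -- For `j ≤ w m n`, compare coefficients of x^{n-jm} in the expansion of x^n; for larger `j`
    -- every term vanishes by support. The free bound `N` allows summation over the possibly longer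
    -- range belonging to `suc n`.
    orthogonal : ∀ n N j → w m n ℕ.< N → ∑< N (λ b → λ₃ n (+ b) * L n b j) ≈ δ j
    orthogonal n N j w<N with j ℕₚ.≤? w m n
    ... | yes j≤w = begin
      ∑< N (λ b → λ₃ n (+ b) * L n b j)
        ≈⟨ ∑<-extend w<N (λ b w<b → trans (*-congʳ (beyond λ₃-support n w<b)) (zeroˡ _)) ⟩
      ∑< (suc (w m n)) (λ b → λ₃ n (+ b) * L n b j)
        ≈⟨ ∑<-cong (suc (w m n)) (λ b b<1+w → *-congˡ (coeff-f-L n (ℕ.s≤s⁻¹ b<1+w) j≤w)) ⟨
      ∑< (suc (w m n)) (λ b → λ₃ n (+ b) * coeff (f m λ₁ (n ∸ m ℕ.* b)) i)
        ≈⟨ coeff-∑ₚ (w m n) (λ₃ n ∘ +_) (λ b → f m λ₁ (n ∸ m ℕ.* b)) i ⟨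
      coeff (∑ₚ[ b ≤ w m n ] (λ₃ n (+ toℕ b) • f m λ₁ (n ∸ m ℕ.* toℕ b))) i
        ≈⟨ x^-expansion n i ⟨
      coeff (x^ n) i
        ≈⟨ coeff-x^-δ n j j≤w ⟩
      δ j ∎
      where i = n ∸ j ℕ.* m
    ... | no j≰w = trans (∑<-zero N (λ b _ → vanish b)) (sym (δ≈0 w<j))
      where
      w<j = ℕₚ.≰⇒> j≰w

      δ≈0 : ∀ {i j} → i ℕ.< j → δ j ≈ 0#
      δ≈0 (s≤s _) = refl

      vanish : ∀ b → λ₃ n (+ b) * L n b j ≈ 0#
      vanish b with b ℕₚ.≤? w m n
      ... | no b≰w = trans (*-congʳ (beyond λ₃-support n (ℕₚ.≰⇒> b≰w))) (zeroˡ _)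
      -- Here j - b > w(n) - b = w(n - bm), so the `λ₁` factor lies beyond its support.
      ... | yes b≤w rewrite ℤₚ.⊖-≥ (ℕₚ.≤-trans b≤w (ℕₚ.<⇒≤ w<j)) =
        trans (*-congˡ (beyond λ₁-support _
          (≡.subst (ℕ._< j ∸ b) (≡.sym (DivMod.[m∸n*o]/o≡m/o∸n n b m))
            (ℕₚ.∸-monoˡ-< w<j b≤w)))) (zeroʳ _)

    -- The contribution of the β-terms to the coefficient of f_{n+1-mb} in x · x^n: it comes from
    -- the preceding summand, x f_{n-m(b-1)}.
    shifted : ℕ → ℕ → Carrier
    shifted n zero    = 0#
    shifted n (suc b) = β (suc n ∸ b ℕ.* m) * λ₃ n (+ b)

    -- Read upwards, the chain multiplies the expansion of x^n by x: `L-recursion` splits each term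
    -- into an α-part at `b` and a β-part at `suc b`, and `∑<-shift` realigns the β-parts.
    x*x^-expansion :
      ∀ n j → ∑< (suc (w m (suc n)))
                 (λ b → (α (suc n ∸ b ℕ.* m) * λ₃ n (+ b) + shifted n b) * L (suc n) b j)
              ≈ δ j
    x*x^-expansion n j = begin
      ∑< N (λ b → (α (r b) * λ₃ n (+ b) + shifted n b) * L (suc n) b j)
        ≈⟨ ∑<-cong N (λ b _ → distribʳ _ _ _) ⟩
      ∑< N (λ b → (α (r b) * λ₃ n (+ b)) * L (suc n) b j + shifted n b * L (suc n) b j)
        ≈⟨ ∑<-+ N _ (λ b → shifted n b * L (suc n) b j) ⟩
      ∑< N (λ b → (α (r b) * λ₃ n (+ b)) * L (suc n) b j)
        + ∑< N (λ b → shifted n b * L (suc n) b j)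
        ≈⟨ +-congˡ (∑<-shift N (λ b → shifted n b * L (suc n) b j) (zeroˡ _) last≈0) ⟩
      ∑< N (λ b → (α (r b) * λ₃ n (+ b)) * L (suc n) b j)
        + ∑< N (λ b → (β (r b) * λ₃ n (+ b)) * L (suc n) (suc b) j)
        ≈⟨ ∑<-+ N _ (λ b → (β (r b) * λ₃ n (+ b)) * L (suc n) (suc b) j) ⟨
      ∑< N (λ b → (α (r b) * λ₃ n (+ b)) * L (suc n) b j
                  + (β (r b) * λ₃ n (+ b)) * L (suc n) (suc b) j)
        ≈⟨ ∑<-cong N (λ b _ → termwise b) ⟨
      ∑< N (λ b → λ₃ n (+ b) * L n b j)
        ≈⟨ orthogonal n N j (s≤s (DivMod./-monoˡ-≤ m (ℕₚ.n≤1+n n))) ⟩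
      δ j ∎
      where
      N = suc (w m (suc n))

      r : ℕ → ℕ
      r b = suc n ∸ b ℕ.* m

      last≈0 : shifted n N * L (suc n) N j ≈ 0#
      -- The argument of `β` is `suc n` modulo `m`, hence below `m`, where `β` is 0.
      last≈0 = trans (*-congʳ (trans (*-congʳ (β-< _
        (≡.subst (ℕ._< m) (DivMod.m%n≡m∸m/n*n (suc n) m) (DivMod.m%n<n (suc n) m))))
        (zeroˡ _))) (zeroˡ _)

      distribute : ∀ {c d e g x y} → x ≈ c * e + d * g →
                   y * x ≈ (c * y) * e + (d * y) * g
      distribute {c} {d} {e} {g} {x} {y} x≈ = begin
        y * x                      ≈⟨ *-congˡ x≈ ⟩
        y * (c * e + d * g)        ≈⟨ distribˡ _ _ _ ⟩
        y * (c * e) + y * (d * g)  ≈⟨ +-cong (x∙yz≈yx∙z _ _ _) (x∙yz≈yx∙z _ _ _) ⟩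
        (c * y) * e + (d * y) * g  ∎

      termwise : ∀ b → λ₃ n (+ b) * L n b j
                       ≈ (α (r b) * λ₃ n (+ b)) * L (suc n) b j
                         + (β (r b) * λ₃ n (+ b)) * L (suc n) (suc b) j
      termwise b with b ℕₚ.≤? w m n
      -- This covers n + 1 = bm, where L-recursion does not apply.
      ... | no b≰w = trans (trans (*-congʳ λ₃≈0) (zeroˡ _))
              (sym (trans (+-cong (vanish _ _) (vanish _ _)) (+-identityʳ 0#)))
        where
        λ₃≈0 = beyond λ₃-support n (ℕₚ.≰⇒> b≰w)

        vanish : ∀ c d → (c * λ₃ n (+ b)) * d ≈ 0#
        vanish c d = trans (*-congʳ (trans (*-congˡ λ₃≈0) (zeroʳ c))) (zeroˡ d)
      ... | yes b≤w = distribute (L-recursion n b j (b≤w⇒bm≤n m b≤w))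

    -- Both sides solve the same triangular system for `suc n`, whose diagonal entries are the units
    -- λ₁(n+1-jm, 0).
    recursion : ∀ n j → j ℕ.≤ w m (suc n) →
                λ₃ (suc n) (+ j) ≈ α (suc n ∸ j ℕ.* m) * λ₃ n (+ j) + shifted n j
    recursion n j j≤w = triangular-injective (L (suc n))
      (λ j<b _ → L-above (suc n) j<b)
      (λ j _ → ≡.subst (λ k → IsUnit (λ₁ (suc n ∸ j ℕ.* m) k)) (≡.sym (ℤₚ.n⊖n≡0 j)) (λ₁-unit _))
      (λ b → λ₃ (suc n) (+ b))
      (λ b → α (suc n ∸ b ℕ.* m) * λ₃ n (+ b) + shifted n b)
      (λ j _ → trans (orthogonal (suc n) _ j ℕₚ.≤-refl) (sym (x*x^-expansion n j)))
      j (s≤s j≤w)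

-- Passage from the uniform recursion to the stated cases.

theorem4p1 :
    ∀ {a ℓ} (R : CommutativeRing a ℓ) (m : ℕ) .{{_ : NonZero m}} →
    let open CommutativeRing R
        open Lambda R
    in
    (λ₁ : Family) (p h : ℕ → Carrier) →
    LambdaRecursive m λ₁ p (λ n _ → h n) →
    (λ₁-unit : ∀ n → IsUnit (λ₁ n 0ℤ)) →
    (p-unit : ∀ n → m ℕ.≤ n → IsUnit (p n)) →
    (λ₃ : Family) →
    TriangularSupport m λ₃ →
    (∀ n → x^ n ≈ₚ ∑ₚ[ b ≤ w m n ] (λ₃ n (+ toℕ b) • f m λ₁ (n ∸ m ℕ.* toℕ b))) →
    (∀ n → λ₁ n 0ℤ * λ₃ n 0ℤ ≈ 1#) →
    ∀ n →
      (λ₃ n 0ℤ ≈ inverse (λ₁-unit n)) ×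
      (∀ k (1≤k : 1 ℕ.≤ k) (k≤w : k ℕ.≤ w m n) →
        let s = n ∸ (k ∸ 1) ℕ.* m in
        λ₃ n (+ k) ≈ A m λ₁ p λ₁-unit p-unit n k * λ₃ (n ∸ 1) (+ k)
                     + (h s * inverse (p-unit s (m≤n∸[k∸1]*m m n k 1≤k k≤w)))
                       * λ₃ (n ∸ 1) (+ k ℤ.- 1ℤ))
theorem4p1 R m λ₁ p h recursive λ₁-unit p-unit λ₃ λ₃-support x^-expansion λ₁*λ₃≈1 n =
  initial , recurrence n
  where
  open CommutativeRing R
  open Lambda R
  open LambdaInverse R m λ₁ p h recursive λ₁-unit p-unit
  open MonoidProperties *-monoid using (cancelˡ)

  initial : λ₃ n 0ℤ ≈ inverse (λ₁-unit n)
  initial = trans (sym (cancelˡ (proj₁ (proj₂ (λ₁-unit n))) (λ₃ n 0ℤ)))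
                  (trans (*-congˡ (λ₁*λ₃≈1 n)) (*-identityʳ _))

  recurrence : ∀ n k (1≤k : 1 ℕ.≤ k) (k≤w : k ℕ.≤ w m n) →
    let s = n ∸ (k ∸ 1) ℕ.* m in
    λ₃ n (+ k) ≈ A m λ₁ p λ₁-unit p-unit n k * λ₃ (n ∸ 1) (+ k)
                 + (h s * inverse (p-unit s (m≤n∸[k∸1]*m m n k 1≤k k≤w)))
                   * λ₃ (n ∸ 1) (+ k ℤ.- 1ℤ)
  recurrence zero (suc k) 1≤k k≤w =
    contradiction (≡.subst (suc k ℕ.≤_) (DivMod.0/n≡0 m) k≤w) λ ()
  recurrence (suc n) (suc k) 1≤k k≤w =
    -- The bound on the column index gives s ≥ m, so `β` at s equals h_s / p_s rather than its
    -- default.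
    trans (recursion λ₃ λ₃-support x^-expansion n (suc k) k≤w)
      (+-congˡ (*-congʳ (β-≥ _ (m≤n∸[k∸1]*m m (suc n) (suc k) 1≤k k≤w))))
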